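{- Let $n>1$ and $t>2$ be two positive integers. Then $\varphi(K_n\boxdot C_t)$ takes the following values in the following cases (nothing is asserted for other pairs $(n,t)$): \[\varphi(K_n \boxdot C_t)= \begin{cases} n+1, & \text{if either } (n,t)=(2,4) \text{ or } (n\geq 9 \text{ and } t=4),\\ n+2, & \text{if either } (n=2 \text{ and } t\neq 4), \text{ or } n\in\{3,4\}, \text{ or } (n\geq 2t+1 \text{ and } t\neq 4). \end{cases}\]
   Context: All graphs are finite and simple. $C_n$ and $K_n$ denote respectively the cycle and the complete graph with $n$ vertices. The subdivision graph $S(G)$ of a graph $G$ is obtained by inserting one new vertex into every edge of $G$. For graphs $G$ and $H$, with $V(G)=\{u_0,\ldots,u_{m-1}\}$, the subdivision-vertex neighbourhood corona (SVN corona) $G\boxdot H$ is the graph obtained from $S(G)$ by adding $m$ vertex-disjoint copies of $H$ (one for each $u_i$) and joining, for each $i$, every vertex of $N_{S(G)}(u_i)$ (the neighbourhood of $u_i$ in $S(G)$) to every vertex of the copy of $H$ associated with $u_i$. A $b$-chromatic coloring of a graph with $k$ colors is a proper coloring with colors $0,\ldots,k-1$ such that, for each color $i$, there is a vertex (a $b$-vertex) of color $i$ having, for each color $j\neq i$, a neighbour of color $j$. The $b$-chromatic number $\varphi(G)$ is the maximum $k$ for which $G$ has a $b$-chromatic coloring with $k$ colors. -}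

module Defs where

open import Data.Empty using (⊥)
open import Data.Fin.Base using (Fin; zero; suc; toℕ; _<_)
open import Data.Fin.Properties using (_≟_; _<?_; +↔⊎; *↔×)
open import Data.Irrelevant as Irrelevant using (Irrelevant; [_])
open import Data.Nat.Base as ℕ using (ℕ; zero; suc)
import Data.Nat.Properties as ℕ
open import Data.Product.Base using (Σ; ∃; _×_; _,_; proj₁; proj₂)
open import Data.Product.Function.NonDependent.Propositional using (_×-↔_)
open import Data.Refinement.Base using (Refinement; Refinement-syntax; _,_; value)
open import Data.Sum.Base as Sum using (_⊎_; inj₁; inj₂)
open import Data.Sum.Function.Propositional using (_⊎-↔_)
open import Function.Base using (_∘_)
open import Function.Bundles using (_↔_; mk↔ₛ′; Inverse)
open import Function.Construct.Composition using (_↔-∘_)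
open import Function.Construct.Identity using (↔-id)
open import Function.Construct.Symmetry using (↔-sym)
open import Function.Properties.Inverse using (↔⇒↣)
open import Level using (0ℓ)
open import Relation.Binary.Core using (Rel)
open import Relation.Binary.Definitions using (Decidable; Symmetric; DecidableEquality)
open import Relation.Binary.PropositionalEquality
  using (_≡_; _≢_; refl; sym; trans; cong; subst; ≢-sym)
open import Relation.Nullary.Decidable using (Dec; yes; no; ¬?; _×-dec_; _⊎-dec_; via-injection)
open import Relation.Nullary.Negation using (¬_; contradiction-irr)
open import Relation.Unary as Unary using (Pred)

Finite : Set → Set
Finite A = ∃ λ n → A ↔ Fin n

⊎-finite : {A B : Set} → Finite A → Finite B → Finite (A ⊎ B)
⊎-finite (m , f) (n , g) = m ℕ.+ n , ↔-sym +↔⊎ ↔-∘ (f ⊎-↔ g)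

×-finite : {A B : Set} → Finite A → Finite B → Finite (A × B)
×-finite (m , f) (n , g) = m ℕ.* n , ↔-sym *↔× ↔-∘ (f ×-↔ g)

refine-Fin : ∀ n {P : Pred (Fin n) 0ℓ} → Unary.Decidable P → Finite [ i ∈ Fin n ∣ P i ]
refine-Fin zero    P? = 0 , mk↔ₛ′ value (λ ()) (λ ()) (λ ())
refine-Fin (suc n) {P} P? with P? zero | refine-Fin n (P? ∘ suc)
... | yes p | m , f = suc m , mk↔ₛ′ to′ from′ to∘from from∘to
  where
  open Inverse f
  to′ : [ i ∈ Fin (suc n) ∣ P i ] → Fin (suc m)
  to′ (zero  , _) = zero
  to′ (suc i , q) = suc (to (i , q))
  from′ : Fin (suc m) → [ i ∈ Fin (suc n) ∣ P i ]
  from′ zero    = zero , [ p ]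
  from′ (suc j) with from j
  ... | i , q = suc i , q
  to∘from : ∀ j → to′ (from′ j) ≡ j
  to∘from zero    = refl
  to∘from (suc j) = cong suc (strictlyInverseˡ j)
  from∘to : ∀ x → from′ (to′ x) ≡ x
  from∘to (zero  , _) = refl
  from∘to (suc i , q) = cong (λ (k , r) → suc k , r) (strictlyInverseʳ (i , q))
... | no ¬p | m , f = m , mk↔ₛ′ to′ from′ strictlyInverseˡ from∘to
  where
  open Inverse f
  to′ : [ i ∈ Fin (suc n) ∣ P i ] → Fin m
  to′ (zero  , [ q ]) = contradiction-irr q ¬p
  to′ (suc i , q) = to (i , q)
  from′ : Fin m → [ i ∈ Fin (suc n) ∣ P i ]
  from′ j with from j
  ... | i , q = suc i , q
  from∘to : ∀ x → from′ (to′ x) ≡ x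
  from∘to (zero  , [ q ]) = contradiction-irr q ¬p
  from∘to (suc i , q) = cong (λ (k , r) → suc k , r) (strictlyInverseʳ (i , q))

refine-finite : {A : Set} {P : Pred A 0ℓ} →
                Finite A → Unary.Decidable P → Finite [ x ∈ A ∣ P x ]
refine-finite {A} {P} (n , f) P? with refine-Fin n (P? ∘ Inverse.from f)
... | m , g = m , g ↔-∘ mk↔ₛ′
  (λ (x , p) → to x , Irrelevant.map (subst P (sym (strictlyInverseʳ x))) p)
  (λ (i , p) → from i , p)
  (λ (i , _) → ext (strictlyInverseˡ i))
  (λ (x , _) → ext (strictlyInverseʳ x))
  where
  open Inverse f
  ext : {B : Set} {Q : Pred B 0ℓ} {x y : Refinement B Q} → value x ≡ value y → x ≡ y
  ext refl = refl

record Graph : Set₁ where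
  infix 4 _~_ _~?_ _≟ᵥ_
  field
    V        : Set
    V-finite : Finite V
    _~_      : Rel V 0ℓ
    _~?_     : Decidable _~_
    ~-sym    : ∀ u v → u ~ v → v ~ u
    ~-irrefl : ∀ u → ¬ (u ~ u)

  index : V → Fin (proj₁ V-finite)
  index = Inverse.to (proj₂ V-finite)

  _≟ᵥ_ : DecidableEquality V
  _≟ᵥ_ = via-injection (↔⇒↣ (proj₂ V-finite)) _≟_

  -- An edge {u , v} is represented once, with its endpoints listed in the
  -- order given by the enumeration of V.
  Edge : Set
  Edge = [ (u , v) ∈ V × V ∣ (index u < index v × u ~ v) ]

  Edge-finite : Finite Edge
  Edge-finite = refine-finite (×-finite V-finite V-finite)
                  (λ (u , v) → (index u <? index v) ×-dec (u ~? v))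

  infix 4 _∈ₑ_
  _∈ₑ_ : V → Edge → Set
  w ∈ₑ ((u , v) , _) = w ≡ u ⊎ w ≡ v

  _∈ₑ?_ : ∀ w e → Dec (w ∈ₑ e)
  w ∈ₑ? ((u , v) , _) = (w ≟ᵥ u) ⊎-dec (w ≟ᵥ v)

K : ℕ → Graph
K n = record
  { V        = Fin n
  ; V-finite = n , ↔-id _
  ; _~_      = _≢_
  ; _~?_     = λ i j → ¬? (i ≟ j)
  ; ~-sym    = λ _ _ → ≢-sym
  ; ~-irrefl = λ _ i≢i → i≢i refl
  }

-- j is the cyclic successor of i, that is, j = i + 1 modulo t.
Next : ∀ {t} → Rel (Fin t) 0ℓ
Next {t} i j = toℕ j ≡ suc (toℕ i) ⊎ (suc (toℕ i) ≡ t × toℕ j ≡ 0)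

next? : ∀ {t} → Decidable (Next {t})
next? {t} i j = (toℕ j ℕ.≟ suc (toℕ i)) ⊎-dec ((suc (toℕ i) ℕ.≟ t) ×-dec (toℕ j ℕ.≟ 0))

C : (t : ℕ) → t ℕ.> 2 → Graph
C t t>2 = record
  { V        = Fin t
  ; V-finite = t , ↔-id _
  ; _~_      = λ i j → Next i j ⊎ Next j i
  ; _~?_     = λ i j → next? i j ⊎-dec next? j i
  ; ~-sym    = λ _ _ → Sum.swap
  ; ~-irrefl = λ i → Sum.[ ¬loop i , ¬loop i ]
  }
  where
  ¬loop : ∀ i → ¬ Next i i
  ¬loop i (inj₁ i≡1+i)         = ℕ.1+n≢n (sym i≡1+i)
  ¬loop i (inj₂ (1+i≡t , i≡0)) =
    ℕ.<⇒≢ (ℕ.<-trans (ℕ.n<1+n 1) t>2) (trans (cong suc (sym i≡0)) 1+i≡t)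

S : Graph → Graph
S G = record
  { V        = V ⊎ Edge
  ; V-finite = ⊎-finite V-finite Edge-finite
  ; _~_      = Adj
  ; _~?_     = adj?
  ; ~-sym    = adj-sym
  ; ~-irrefl = λ { (inj₁ _) () ; (inj₂ _) () }
  }
  where
  open Graph G
  Adj : Rel (V ⊎ Edge) 0ℓ
  Adj (inj₁ _) (inj₁ _) = ⊥
  Adj (inj₁ u) (inj₂ e) = u ∈ₑ e
  Adj (inj₂ e) (inj₁ u) = u ∈ₑ e
  Adj (inj₂ _) (inj₂ _) = ⊥
  adj? : Decidable Adj
  adj? (inj₁ _) (inj₁ _) = no λ ()
  adj? (inj₁ u) (inj₂ e) = u ∈ₑ? e
  adj? (inj₂ e) (inj₁ u) = u ∈ₑ? e
  adj? (inj₂ _) (inj₂ _) = no λ ()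
  adj-sym : ∀ x y → Adj x y → Adj y x
  adj-sym (inj₁ _) (inj₂ _) p = p
  adj-sym (inj₂ _) (inj₁ _) p = p

-- The vertex inj₂ (u , h) is the vertex h in the copy of H associated with u.
infixl 6 _⊡_
_⊡_ : Graph → Graph → Graph
G ⊡ H = record
  { V        = SG.V ⊎ (G.V × H.V)
  ; V-finite = ⊎-finite SG.V-finite (×-finite G.V-finite H.V-finite)
  ; _~_      = Adj
  ; _~?_     = adj?
  ; ~-sym    = adj-sym
  ; ~-irrefl = λ { (inj₁ x) → SG.~-irrefl x ; (inj₂ (_ , h)) → H.~-irrefl h ∘ proj₂ }
  }
  where
  module G  = Graph G
  module H  = Graph H
  module SG = Graph (S G)
  Adj : Rel (SG.V ⊎ (G.V × H.V)) 0ℓ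
  Adj (inj₁ x)       (inj₁ y)       = x SG.~ y
  Adj (inj₁ x)       (inj₂ (u , _)) = inj₁ u SG.~ x
  Adj (inj₂ (u , _)) (inj₁ x)       = inj₁ u SG.~ x
  Adj (inj₂ (u , h)) (inj₂ (v , k)) = u ≡ v × h H.~ k
  adj? : Decidable Adj
  adj? (inj₁ x)       (inj₁ y)       = x SG.~? y
  adj? (inj₁ x)       (inj₂ (u , _)) = inj₁ u SG.~? x
  adj? (inj₂ (u , _)) (inj₁ x)       = inj₁ u SG.~? x
  adj? (inj₂ (u , h)) (inj₂ (v , k)) = (u G.≟ᵥ v) ×-dec (h H.~? k)
  adj-sym : ∀ a b → Adj a b → Adj b a
  adj-sym (inj₁ x)       (inj₁ y)       p         = SG.~-sym x y p
  adj-sym (inj₁ _)       (inj₂ _)       p         = p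
  adj-sym (inj₂ _)       (inj₁ _)       p         = p
  adj-sym (inj₂ (_ , h)) (inj₂ (_ , k)) (u≡v , p) = sym u≡v , H.~-sym h k p

module _ (G : Graph) where
  open Graph G

  Proper : ∀ {k} → (V → Fin k) → Set
  Proper c = ∀ u v → u ~ v → c u ≢ c v

  BVertex : ∀ {k} → (V → Fin k) → V → Set
  BVertex c v = ∀ j → j ≢ c v → ∃ λ w → v ~ w × c w ≡ j

  BChromatic : ∀ {k} → (V → Fin k) → Set
  BChromatic c = Proper c × (∀ i → ∃ λ v → c v ≡ i × BVertex c v)

  BColorable : ℕ → Set
  BColorable k = Σ (V → Fin k) BChromatic

-- φ[ G ]≡ k says that the b-chromatic number of G, the maximum number of colors
-- of a b-chromatic coloring, equals k.
infix 4 φ[_]≡_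
φ[_]≡_ : Graph → ℕ → Set
φ[ G ]≡ k = BColorable G k × (∀ l → BColorable G l → l ℕ.≤ k)

{-# OPTIONS --safe #-}
module Submission where

open import Defs
open import Algebra.Bundles using (CommutativeRing)
open import Data.Bool.Base using (Bool; false; _xor_)
open import Data.Bool.Properties using (xor-∧-commutativeRing; xor-assoc; xor-same; xor-identityʳ)
open import Data.Empty using (⊥-elim-irr)
open import Data.Fin.Base using (Fin; zero; suc; toℕ; fromℕ; fromℕ<; inject₁; _↑ˡ_; _↑ʳ_; combine; remQuot; punchIn; punchOut; finToFun; funToFin)
open import Data.Fin.Patterns using (0F; 1F; 2F; 3F; 4F; 5F)
open import Data.Fin.Permutation using (Permutation; permutation)
open import Data.Fin.Properties using (_≟_; toℕ<n; toℕ-injective; toℕ-fromℕ; toℕ-fromℕ<; toℕ-inject₁; suc-injective; <-cmp; injective⇒≤; all?; any?; 2↔Bool; combine-injective; remQuot-combine; finToFun-funToFin; funToFin-finToFin; punchIn-injective; punchInᵢ≢i; punchIn-punchOut)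
open import Data.Irrelevant using ([_])
open import Data.Nat.Base as ℕ using (ℕ; zero; suc; _+_; _*_; _∸_; _^_; _>_; _≥_; _≤_; s≤s; z≤n)
open import Data.Nat.DivMod using (_%_; _mod_; m%n<n; m<n⇒m%n≡m; [m+n]%n≡m%n; %-distribˡ-+; m%n%n≡m%n)
import Data.Nat.Properties as ℕ
open import Data.Product.Base using (Σ; ∃; ∃₂; _×_; _,_; proj₁; proj₂)
open import Data.Refinement.Base using (_,_)
open import Data.Sum.Base using (_⊎_; inj₁; inj₂)
open import Function.Base using (_∘_; case_of_)
open import Function.Bundles using (Inverse)
open import Relation.Binary.Definitions using (tri<; tri≈; tri>)
open import Relation.Binary.PropositionalEquality using (_≡_; _≢_; _≗_; refl; sym; trans; cong; cong₂; subst; ≢-sym; module ≡-Reasoning)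
open import Relation.Nullary.Decidable using (Dec; yes; no; from-yes; ¬?; _×-dec_; _⊎-dec_; _→-dec_)
open import Relation.Nullary.Negation using (¬_; contradiction)
open import Algebra.Properties.CommutativeMonoid.Sum
  (CommutativeRing.+-commutativeMonoid xor-∧-commutativeRing) using (sum; sum-permute)

-- A vertex of K n has degree n − 1, a vertex in a copy of the cycle n + 1 and an
-- edge vertex 2t + 2, so with more than n + 2 colors all b-vertices are edge
-- vertices, which are too few or of too small degree.
--
-- If t = 4, a copy containing a b-vertex for n + 2 colors repeats a color on exactly
-- one diagonal, and that is the color of all its b-vertices. An edge vertex p q can
-- be a b-vertex only if n = 2, where it is the only edge and contributes one color, or
-- if n = 9 and its closed neighborhood is rainbow; then over 𝔽₂ the unit vector
-- of its color is the all-ones vector plus the indicators of the colors found on p and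
-- q with their copies. So all n + 2 unit vectors would lie in a span of n + 1 vectors.
--
-- For the lower bounds the copy at p uses colors missing from the edges at p, the
-- edges are colored by sums of residues, and every color has to be missing somewhere.

-- Surjections and separating families on finite sets

Onto : {A B : Set} → (A → B) → Set
Onto f = ∀ b → ∃ λ a → f a ≡ b

section-injective : {A B : Set} {f : A → B} (onto : Onto f) →
                    ∀ {b b′} → proj₁ (onto b) ≡ proj₁ (onto b′) → b ≡ b′
section-injective {f = f} onto {b} {b′} eq =
  trans (sym (proj₂ (onto b))) (trans (cong f eq) (proj₂ (onto b′)))

onto⇒≥ : ∀ {k d} {f : Fin d → Fin k} → Onto f → k ≤ d
onto⇒≥ onto = injective⇒≤ (section-injective onto)

-- If `b` is missed, punching it out embeds `Fin (suc k)` into `Fin k`.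
injective⇒onto : ∀ {k} {g : Fin k → Fin k} → (∀ {i j} → g i ≡ g j → i ≡ j) → Onto g
injective⇒onto {suc k} {g} inj b with any? (λ a → g a ≟ b)
... | yes found = found
... | no  none  = contradiction (injective⇒≤ {f = λ a → punchOut (avoids a)} g′-inj) ℕ.1+n≰n
  where
  avoids : ∀ a → b ≢ g a
  avoids a b≡ga = none (a , sym b≡ga)
  g′-inj : ∀ {i j} → punchOut (avoids i) ≡ punchOut (avoids j) → i ≡ j
  g′-inj {i} {j} eq = inj (trans (sym (punchIn-punchOut (avoids i)))
                          (trans (cong (punchIn b) eq) (punchIn-punchOut (avoids j))))

-- The chosen section is injective, hence onto by `injective⇒onto`. So every `i` is a chosen
-- preimage, which makes the section a two-sided inverse.
onto⇒permutation : ∀ {k} {f : Fin k → Fin k} → Onto f → Permutation k k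
onto⇒permutation {f = f} onto = permutation f (proj₁ ∘ onto) (proj₂ ∘ onto) left
  where
  left : ∀ i → proj₁ (onto (f i)) ≡ i
  left i with injective⇒onto (section-injective onto) i
  ... | b , refl = cong (proj₁ ∘ onto) (proj₂ (onto b))

onto⇒injective : ∀ {k} {f : Fin k → Fin k} → Onto f → ∀ {i j} → f i ≡ f j → i ≡ j
onto⇒injective onto {i} {j} eq = trans (sym (strictlyInverseʳ i))
                                   (trans (cong from eq) (strictlyInverseʳ j))
  where open Inverse (onto⇒permutation onto)

funToFin-cong : ∀ {m n} {f g : Fin m → Fin n} → f ≗ g → funToFin f ≡ funToFin g
funToFin-cong {zero}  eq = refl
funToFin-cong {suc m} eq = cong₂ combine (eq zero) (funToFin-cong (eq ∘ suc))

-- The dimension bound, obtained by counting: tuples of values embed the 2 ^ k vectors into the 2 ^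
-- m possible tuples.
separating⇒≤ : ∀ {k m} (ev : Fin m → (Fin k → Bool) → Bool) →
  (∀ x y → (∀ i → ev i x ≡ ev i y) → x ≗ y) → k ≤ m
separating⇒≤ {k} {m} ev separating = ℕ.≮⇒≥ λ m<k →
  ℕ.≤⇒≯ (injective⇒≤ encode-injective) (ℕ.^-monoʳ-< 2 (ℕ.n<1+n 1) m<k)
  where
  open Inverse 2↔Bool
  encode : Fin (2 ^ k) → Fin (2 ^ m)
  encode a = funToFin (λ i → from (ev i (to ∘ finToFun a)))
  from-injective : ∀ {a b} → from a ≡ from b → a ≡ b
  from-injective {a} {b} eq = trans (sym (strictlyInverseˡ a)) (trans (cong to eq) (strictlyInverseˡ b))
  to-injective : ∀ {a b} → to a ≡ to b → a ≡ b
  to-injective {a} {b} eq = trans (sym (strictlyInverseʳ a)) (trans (cong from eq) (strictlyInverseʳ b))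
  encode-injective : ∀ {a b} → encode a ≡ encode b → a ≡ b
  encode-injective {a} {b} eq = begin
    a                      ≡⟨ funToFin-finToFin {k} {2} a ⟨
    funToFin (finToFun {2} {k} a)  ≡⟨ funToFin-cong (λ j → to-injective (separating _ _ same j)) ⟩
    funToFin (finToFun {2} {k} b)  ≡⟨ funToFin-finToFin {k} {2} b ⟩
    b                      ∎
    where
    open ≡-Reasoning
    same : ∀ i → ev i (to ∘ finToFun a) ≡ ev i (to ∘ finToFun b)
    same i = from-injective (begin
      _                          ≡⟨ finToFun-funToFin _ i ⟨
      finToFun {2} {m} (encode a) i ≡⟨ cong (λ z → finToFun {2} {m} z i) eq ⟩
      finToFun {2} {m} (encode b) i ≡⟨ finToFun-funToFin _ i ⟩
      _                          ∎)

-- Colorings of cycles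

proper? : ∀ {t r} (t>2 : t > 2) (κ : Fin t → Fin r) → Dec (Proper (C t t>2) κ)
proper? {t} t>2 κ = all? λ u → all? λ v → (u ~? v) →-dec ¬? (κ u ≟ κ v)
  where open Graph (C t t>2)

bVertex? : ∀ {t r} (t>2 : t > 2) (κ : Fin t → Fin r) → ∀ v → Dec (BVertex (C t t>2) κ v)
bVertex? {t} t>2 κ v = all? λ j → ¬? (j ≟ κ v) →-dec any? λ w → (v ~? w) ×-dec (κ w ≟ j)
  where open Graph (C t t>2)

bChromatic? : ∀ {t r} (t>2 : t > 2) (κ : Fin t → Fin r) → Dec (BChromatic (C t t>2) κ)
bChromatic? t>2 κ = proper? t>2 κ ×-dec
  all? λ i → any? λ v → (κ v ≟ i) ×-dec bVertex? t>2 κ v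

C₄-2-colorable : (4>2 : 4 > 2) → BColorable (C 4 4>2) 2
C₄-2-colorable 4>2 = κ , from-yes (bChromatic? 4>2 κ)
  where
  κ : Fin 4 → Fin 2
  κ 0F = 0F
  κ 1F = 1F
  κ 2F = 0F
  κ 3F = 1F

alternate : ℕ → Fin 3
alternate zero          = 0F
alternate (suc zero)    = 1F
alternate (suc (suc m)) = alternate m

alternate-proper : ∀ m → alternate m ≢ alternate (suc m)
alternate-proper (suc zero)    ()
alternate-proper (suc (suc m)) = alternate-proper m

alternate≢2 : ∀ m → alternate m ≢ 2F
alternate≢2 (suc (suc m)) = alternate≢2 m

-- 0 1 2 followed by 0 1 0 1 …, with the last color replaced by 2.
pattern₃ : ℕ → ℕ → Fin 3
pattern₃ t 0 = 0F
pattern₃ t 1 = 1F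
pattern₃ t 2 = 2F
pattern₃ t (suc (suc (suc m))) with 4 + m ℕ.≟ t
... | yes _ = 2F
... | no  _ = alternate m

-- In the triangle position 2 is followed by position 0; for t ≥ 5 position 3 is not yet the last
-- and has color 0.
after-2 : ∀ s (t>2 : 3 + s > 2) → 3 + s ≢ 4 →
          ∃ λ w → Graph._~_ (C (3 + s) t>2) 2F w × pattern₃ (3 + s) (toℕ w) ≡ 0F
after-2 0             _ _   = 0F , inj₁ (inj₂ (refl , refl)) , refl
after-2 1             _ 4≢4 = contradiction refl 4≢4
after-2 (suc (suc _)) _ _   = 3F , inj₁ (inj₁ refl) , refl

C-3-colorable : ∀ t (t>2 : t > 2) → t ≢ 4 → BColorable (C t t>2) 3
C-3-colorable 1 (s≤s ()) _
C-3-colorable 2 (s≤s (s≤s ())) _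
C-3-colorable t@(suc (suc (suc t′))) t>2 t≢4 = κ , proper , bvertices
  where
  κ : Fin t → Fin 3
  κ = pattern₃ t ∘ toℕ
  last : Fin t
  last = fromℕ (2 + t′)
  step : ∀ i → suc i ℕ.< t → pattern₃ t i ≢ pattern₃ t (suc i)
  step 0 _ ()
  step 1 _ ()
  step 2 _ eq with 4 ℕ.≟ t
  -- For t = 4 position 3 is the last one and repeats the color 2.
  step 2 _ eq | yes 4≡t = t≢4 (sym 4≡t)
  step 2 _ () | no  _
  step (suc (suc (suc m))) i<t eq with 4 + m ℕ.≟ t | 5 + m ℕ.≟ t
  ... | yes i≡t | _     = ℕ.<⇒≢ i<t i≡t
  ... | no  _   | yes _ = alternate≢2 m eq
  ... | no  _   | no  _ = alternate-proper m eq
  wrap : ∀ i → suc i ≡ t → pattern₃ t i ≢ 0F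
  wrap 2 _ ()
  wrap (suc (suc (suc m))) i≡t eq with 4 + m ℕ.≟ t
  wrap (suc (suc (suc m))) i≡t () | yes _
  ... | no i≢t = i≢t i≡t
  next-proper : ∀ u v → Next u v → κ u ≢ κ v
  next-proper u v (inj₁ v≡1+u) eq =
    step (toℕ u) (subst (ℕ._< t) v≡1+u (toℕ<n v)) (trans eq (cong (pattern₃ t) v≡1+u))
  next-proper u v (inj₂ (u≡t , v≡0)) eq = wrap (toℕ u) u≡t (trans eq (cong (pattern₃ t) v≡0))
  proper : Proper (C t t>2) κ
  proper u v (inj₁ u→v) = next-proper u v u→v
  proper u v (inj₂ v→u) = ≢-sym (next-proper v u v→u)
  last≡2 : ∀ i → suc i ≡ t → pattern₃ t i ≡ 2F
  last≡2 2 _ = refl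
  last≡2 (suc (suc (suc m))) i≡t with 4 + m ℕ.≟ t
  ... | yes _   = refl
  ... | no i≢t = contradiction i≡t i≢t
  bvertex₀ : BVertex (C t t>2) κ 0F
  bvertex₀ 0F 0≢ = contradiction refl 0≢
  bvertex₀ 1F _  = 1F , inj₁ (inj₁ refl) , refl
  bvertex₀ 2F _  = last , inj₂ (inj₂ (cong suc (toℕ-fromℕ _) , refl))
                 , last≡2 _ (cong suc (toℕ-fromℕ _))
  bvertex₁ : BVertex (C t t>2) κ 1F
  bvertex₁ 0F _  = 0F , inj₂ (inj₁ refl) , refl
  bvertex₁ 1F 1≢ = contradiction refl 1≢
  bvertex₁ 2F _  = 2F , inj₁ (inj₁ refl) , refl
  bvertex₂ : BVertex (C t t>2) κ 2F
  bvertex₂ 0F _  = after-2 t′ t>2 t≢4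
  bvertex₂ 1F _  = 1F , inj₂ (inj₁ refl) , refl
  bvertex₂ 2F 2≢ = contradiction refl 2≢
  bvertices : ∀ i → ∃ λ v → κ v ≡ i × BVertex (C t t>2) κ v
  bvertices 0F = 0F , refl , bvertex₀
  bvertices 1F = 1F , refl , bvertex₁
  bvertices 2F = 2F , refl , bvertex₂

-- The colorings for n = 3 and n = 4 need just one vertex seeing all three colors, instead of a
-- b-vertex of each color. This also covers t = 4.
C-rainbow : ∀ t (t>2 : t > 2) → Σ (Fin t → Fin 3) λ κ →
            Proper (C t t>2) κ × ∃ λ h → κ h ≡ 0F × BVertex (C t t>2) κ h
C-rainbow t t>2 with t ℕ.≟ 4
C-rainbow t t>2 | no t≢4 with C-3-colorable t t>2 t≢4
... | κ , proper , bvertices = κ , proper , bvertices 0F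
C-rainbow 4 4>2 | yes refl =
  κ , from-yes (proper? 4>2 κ) , 0F , refl , from-yes (bVertex? 4>2 κ 0F)
  where
  κ : Fin 4 → Fin 3
  κ 0F = 0F
  κ 1F = 1F
  κ 2F = 0F
  κ 3F = 2F

-- Edges of complete graphs

module _ {n : ℕ} where
  open Graph (K n)

  join : ∀ {p q} → p ≢ q → ∃ λ (e : Edge) → p ∈ₑ e × q ∈ₑ e
  join {p} {q} p≢q with <-cmp p q
  ... | tri< p<q _ _ = ((p , q) , [ p<q , p≢q ]) , inj₁ refl , inj₂ refl
  ... | tri≈ _ p≡q _ = contradiction p≡q p≢q
  ... | tri> _ _ q<p = ((q , p) , [ q<p , ≢-sym p≢q ]) , inj₂ refl , inj₁ refl

  -- Endpoints are listed in increasing order, so a pair has one representative; the order proofs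
  -- are irrelevant, which leaves `refl` or a contradiction.
  edge-unique : ∀ {p q} (e e′ : Edge) → p ≢ q →
                p ∈ₑ e → q ∈ₑ e → p ∈ₑ e′ → q ∈ₑ e′ → e ≡ e′
  edge-unique _ _ p≢q (inj₁ refl) (inj₁ refl) _ _ = contradiction refl p≢q
  edge-unique _ _ p≢q (inj₂ refl) (inj₂ refl) _ _ = contradiction refl p≢q
  edge-unique _ _ p≢q _ _ (inj₁ refl) (inj₁ refl) = contradiction refl p≢q
  edge-unique _ _ p≢q _ _ (inj₂ refl) (inj₂ refl) = contradiction refl p≢q
  edge-unique _ _ _ (inj₁ refl) (inj₂ refl) (inj₁ refl) (inj₂ refl) = refl
  edge-unique _ _ _ (inj₂ refl) (inj₁ refl) (inj₂ refl) (inj₁ refl) = refl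
  edge-unique (_ , [ l ]) (_ , [ l′ ]) _
    (inj₁ refl) (inj₂ refl) (inj₂ refl) (inj₁ refl) = ⊥-elim-irr (ℕ.<-asym (proj₁ l) (proj₁ l′))
  edge-unique (_ , [ l ]) (_ , [ l′ ]) _
    (inj₂ refl) (inj₁ refl) (inj₁ refl) (inj₂ refl) = ⊥-elim-irr (ℕ.<-asym (proj₁ l) (proj₁ l′))

  other-end : ∀ {p} (e : Edge) → p ∈ₑ e → ∃ λ q → p ≢ q × q ∈ₑ e
  other-end ((_ , q) , [ l ]) (inj₁ refl) = q , (λ eq → ⊥-elim-irr (proj₂ l eq)) , inj₂ refl
  other-end ((q , _) , [ l ]) (inj₂ refl) = q , (λ eq → ⊥-elim-irr (proj₂ l (sym eq))) , inj₁ refl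

-- Colorings from an edge coloring ε of K n, a proper coloring κ of the cycle
-- and, for each vertex p of K n, a palette π p for the copy of the cycle at p.

module Palettes {n t r k : ℕ} (t>2 : t > 2)
  (κ : Fin t → Fin r) (κ-proper : Proper (C t t>2) κ)
  (ε : Fin n → Fin n → Fin k) (ε-sym : ∀ p q → ε p q ≡ ε q p)
  (π : Fin n → Fin r → Fin k) (π-injective : ∀ p {a b} → π p a ≡ π p b → a ≡ b)
  (ε≢π : ∀ {p q} a → p ≢ q → ε p q ≢ π p a)
  where
  open Graph (K n ⊡ C t t>2) using (V; _~_)
  open Graph (K n) using (Edge; _∈ₑ_)

  color : V → Fin k
  -- `p` has the same edge vertices as neighbors as its copy and is not joined to the copy, so any
  -- color of the palette suits it; that of position 0 is taken.
  color (inj₁ (inj₁ p))             = π p (κ (fromℕ< (ℕ.<-trans (s≤s z≤n) t>2)))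
  color (inj₁ (inj₂ ((p , q) , _))) = ε p q
  color (inj₂ (p , h))              = π p (κ h)

  color-edge : ∀ {p q} (e : Edge) → p ≢ q → p ∈ₑ e → q ∈ₑ e → color (inj₁ (inj₂ e)) ≡ ε p q
  color-edge e p≢q (inj₁ refl) (inj₁ refl) = contradiction refl p≢q
  color-edge e p≢q (inj₁ refl) (inj₂ refl) = refl
  color-edge e p≢q (inj₂ refl) (inj₁ refl) = ε-sym _ _
  color-edge e p≢q (inj₂ refl) (inj₂ refl) = contradiction refl p≢q

  color-edge≢π : ∀ {p} (e : Edge) a → p ∈ₑ e → color (inj₁ (inj₂ e)) ≢ π p a
  color-edge≢π e a p∈e eq with other-end e p∈e
  ... | q , p≢q , q∈e = ε≢π a p≢q (trans (sym (color-edge e p≢q p∈e q∈e)) eq)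

  color-proper : Proper (K n ⊡ C t t>2) color
  color-proper (inj₁ (inj₁ p)) (inj₁ (inj₂ e)) p∈e = ≢-sym (color-edge≢π e _ p∈e)
  color-proper (inj₁ (inj₂ e)) (inj₁ (inj₁ p)) p∈e = color-edge≢π e _ p∈e
  color-proper (inj₁ (inj₂ e)) (inj₂ (p , h))  p∈e = color-edge≢π e _ p∈e
  color-proper (inj₂ (p , h))  (inj₁ (inj₂ e)) p∈e = ≢-sym (color-edge≢π e _ p∈e)
  color-proper (inj₂ (p , h))  (inj₂ (p , h′)) (refl , h~h′) = κ-proper h h′ h~h′ ∘ π-injective p

  -- A copy vertex sees all edges at `p`, and its neighbors on the cycle supply the rest of the
  -- palette.
  copy-bvertex : ∀ p h → BVertex (C t t>2) κ h →
    (∀ j → (∃ λ q → p ≢ q × ε p q ≡ j) ⊎ (∃ λ a → π p a ≡ j)) →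
    BVertex (K n ⊡ C t t>2) color (inj₂ (p , h))
  copy-bvertex p h h-bvertex seen j j≢ with seen j
  ... | inj₁ (q , p≢q , refl) with join p≢q
  ...   | e , p∈e , q∈e = inj₁ (inj₂ e) , p∈e , color-edge e p≢q p∈e q∈e
  copy-bvertex p h h-bvertex seen j j≢ | inj₂ (a , refl)
    with h-bvertex a (j≢ ∘ cong (π p))
  ... | h′ , h~h′ , refl = inj₂ (p , h′) , (refl , h~h′) , refl

  -- An edge vertex sees both copies entirely, hence both palettes as soon as `κ` takes all its
  -- values.
  edge-bvertex : ∀ {p q} (e : Edge) → p ≢ q → p ∈ₑ e → q ∈ₑ e → Onto κ →
    (∀ j → j ≢ ε p q → ∃ λ a → π p a ≡ j ⊎ π q a ≡ j) →
    BVertex (K n ⊡ C t t>2) color (inj₁ (inj₂ e))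
  edge-bvertex e p≢q p∈e q∈e κ-onto seen j j≢
    with seen j (λ eq → j≢ (trans eq (sym (color-edge e p≢q p∈e q∈e))))
  ... | a , π≡j with κ-onto a
  ...   | h , refl with π≡j
  ...     | inj₁ πp≡j = inj₂ (_ , h) , p∈e , πp≡j
  ...     | inj₂ πq≡j = inj₂ (_ , h) , q∈e , πq≡j

  edge-bcolor : ∀ {p q} → p ≢ q → Onto κ →
    (∀ j → j ≢ ε p q → ∃ λ a → π p a ≡ j ⊎ π q a ≡ j) →
    ∃ λ v → color v ≡ ε p q × BVertex (K n ⊡ C t t>2) color v
  edge-bcolor p≢q κ-onto seen with join p≢q
  ... | e , p∈e , q∈e =
    inj₁ (inj₂ e) , color-edge e p≢q p∈e q∈e , edge-bvertex e p≢q p∈e q∈e κ-onto seen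

-- Colorings for n = 2, 3 and 4

K₂-colorable : ∀ {t r} (t>2 : t > 2) → BColorable (C t t>2) r → BColorable (K 2 ⊡ C t t>2) (suc r)
K₂-colorable {t} {r} t>2 (κ , κ-proper , κ-bvertices) = color , color-proper , bvertices
  where
  ε : Fin 2 → Fin 2 → Fin (suc r)
  ε _ _ = zero
  open Palettes t>2 κ κ-proper ε (λ _ _ → refl) (λ _ → suc) (λ _ → suc-injective) (λ _ _ ())
  0≢1 : 0F ≢ 1F
  0≢1 ()
  seen : ∀ j → (∃ λ q → 0F ≢ q × ε 0F q ≡ j) ⊎ (∃ λ a → suc a ≡ j)
  seen zero    = inj₁ (1F , 0≢1 , refl)
  seen (suc j) = inj₂ (j , refl)
  bvertices : ∀ j → ∃ λ v → color v ≡ j × BVertex (K 2 ⊡ C t t>2) color v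
  bvertices zero = edge-bcolor {0F} {1F} 0≢1 (λ a → proj₁ (κ-bvertices a) , proj₁ (proj₂ (κ-bvertices a)))
    λ { zero 0≢0 → contradiction refl 0≢0 ; (suc a) _ → a , inj₁ refl }
  bvertices (suc a) with κ-bvertices a
  ... | h , refl , h-bvertex = inj₂ (0F , h) , refl , copy-bvertex 0F h h-bvertex seen

bvertex-onto : ∀ {t} (t>2 : t > 2) (κ : Fin t → Fin 3) h → BVertex (C t t>2) κ h → Onto κ
bvertex-onto t>2 κ h h-bvertex a with a ≟ κ h
... | yes a≡ = h , sym a≡
... | no  a≢ with h-bvertex a a≢
...   | h′ , _ , κh′≡a = h′ , κh′≡a

K₃-colorable : ∀ {t} (t>2 : t > 2) → BColorable (K 3 ⊡ C t t>2) 5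
K₃-colorable {t} t>2 with C-rainbow t t>2
... | κ , κ-proper , h , κh≡0 , h-bvertex = color , color-proper , bvertices
  where
  ε : Fin 3 → Fin 3 → Fin 5
  ε 0F 1F = 0F
  ε 1F 0F = 0F
  ε 0F 2F = 1F
  ε 2F 0F = 1F
  ε 1F 2F = 2F
  ε 2F 1F = 2F
  ε _  _  = 0F
  -- A palette consists of 3, 4 and the color of the opposite edge. Index 0, the color of `h`,
  -- stands for 3 at `0F` and for 4 at `1F`: these two copies supply the b-vertices that the edges
  -- do not.
  π : Fin 3 → Fin 3 → Fin 5
  π 0F 0F = 3F
  π 0F 1F = 2F
  π 0F 2F = 4F
  π 1F 0F = 4F
  π 1F 1F = 1F
  π 1F 2F = 3F
  π 2F 0F = 0F
  π 2F 1F = 3F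
  π 2F 2F = 4F
  ε-sym : ∀ p q → ε p q ≡ ε q p
  ε-sym = from-yes (all? λ p → all? λ q → ε p q ≟ ε q p)
  π-injective : ∀ p a b → π p a ≡ π p b → a ≡ b
  π-injective = from-yes (all? λ p → all? λ a → all? λ b → (π p a ≟ π p b) →-dec (a ≟ b))
  ε≢π : ∀ p q a → p ≢ q → ε p q ≢ π p a
  ε≢π = from-yes (all? λ p → all? λ q → all? λ a → ¬? (p ≟ q) →-dec ¬? (ε p q ≟ π p a))
  edge-seen : ∀ p q → p ≢ q → ∀ j → j ≢ ε p q → ∃ λ a → π p a ≡ j ⊎ π q a ≡ j
  edge-seen = from-yes (all? λ p → all? λ q → ¬? (p ≟ q) →-dec all? λ j →
    ¬? (j ≟ ε p q) →-dec any? λ a → (π p a ≟ j) ⊎-dec (π q a ≟ j))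
  copy-seen : ∀ p j → (∃ λ q → p ≢ q × ε p q ≡ j) ⊎ (∃ λ a → π p a ≡ j)
  copy-seen = from-yes (all? λ p → all? λ j →
    any? (λ q → ¬? (p ≟ q) ×-dec (ε p q ≟ j)) ⊎-dec any? (λ a → π p a ≟ j))
  open Palettes t>2 κ κ-proper ε ε-sym π (λ p → π-injective p _ _) (λ a → ε≢π _ _ a)
  BColor : Fin 5 → Set
  BColor j = ∃ λ v → color v ≡ j × BVertex (K 3 ⊡ C t t>2) color v
  edge : ∀ p q → p ≢ q → BColor (ε p q)
  edge p q p≢q = edge-bcolor {p} {q} p≢q (bvertex-onto t>2 κ h h-bvertex) (edge-seen p q p≢q)
  copy : ∀ p → BColor (π p 0F)
  copy p = inj₂ (p , h) , cong (π p) κh≡0 , copy-bvertex p h h-bvertex (copy-seen p)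
  bvertices : ∀ j → BColor j
  bvertices 0F = edge 0F 1F λ ()
  bvertices 1F = edge 0F 2F λ ()
  bvertices 2F = edge 1F 2F λ ()
  bvertices 3F = copy 0F
  bvertices 4F = copy 1F

-- The six edges get the six colors and are all b-vertices: every edge other than p q avoids p or q,
-- so its color occurs in one of the two palettes.
K₄-colorable : ∀ {t} (t>2 : t > 2) → BColorable (K 4 ⊡ C t t>2) 6
K₄-colorable {t} t>2 with C-rainbow t t>2
... | κ , κ-proper , h , _ , h-bvertex = color , color-proper , bvertices
  where
  ε : Fin 4 → Fin 4 → Fin 6
  ε 0F 1F = 0F
  ε 1F 0F = 0F
  ε 0F 2F = 1F
  ε 2F 0F = 1F
  ε 0F 3F = 2F
  ε 3F 0F = 2F
  ε 1F 2F = 3F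
  ε 2F 1F = 3F
  ε 1F 3F = 4F
  ε 3F 1F = 4F
  ε 2F 3F = 5F
  ε 3F 2F = 5F
  ε _  _  = 0F
  -- The colors of the edges opposite to p.
  π : Fin 4 → Fin 3 → Fin 6
  π 0F 0F = 3F
  π 0F 1F = 4F
  π 0F 2F = 5F
  π 1F 0F = 1F
  π 1F 1F = 2F
  π 1F 2F = 5F
  π 2F 0F = 0F
  π 2F 1F = 2F
  π 2F 2F = 4F
  π 3F 0F = 0F
  π 3F 1F = 1F
  π 3F 2F = 3F
  ε-sym : ∀ p q → ε p q ≡ ε q p
  ε-sym = from-yes (all? λ p → all? λ q → ε p q ≟ ε q p)
  π-injective : ∀ p a b → π p a ≡ π p b → a ≡ b
  π-injective = from-yes (all? λ p → all? λ a → all? λ b → (π p a ≟ π p b) →-dec (a ≟ b))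
  ε≢π : ∀ p q a → p ≢ q → ε p q ≢ π p a
  ε≢π = from-yes (all? λ p → all? λ q → all? λ a → ¬? (p ≟ q) →-dec ¬? (ε p q ≟ π p a))
  edge-seen : ∀ p q → p ≢ q → ∀ j → j ≢ ε p q → ∃ λ a → π p a ≡ j ⊎ π q a ≡ j
  edge-seen = from-yes (all? λ p → all? λ q → ¬? (p ≟ q) →-dec all? λ j →
    ¬? (j ≟ ε p q) →-dec any? λ a → (π p a ≟ j) ⊎-dec (π q a ≟ j))
  open Palettes t>2 κ κ-proper ε ε-sym π (λ p → π-injective p _ _) (λ a → ε≢π _ _ a)
  BColor : Fin 6 → Set
  BColor j = ∃ λ v → color v ≡ j × BVertex (K 4 ⊡ C t t>2) color v
  edge : ∀ p q → p ≢ q → BColor (ε p q)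
  edge p q p≢q = edge-bcolor {p} {q} p≢q (bvertex-onto t>2 κ h h-bvertex) (edge-seen p q p≢q)
  bvertices : ∀ j → BColor j
  bvertices 0F = edge 0F 1F λ ()
  bvertices 1F = edge 0F 2F λ ()
  bvertices 2F = edge 0F 3F λ ()
  bvertices 3F = edge 1F 2F λ ()
  bvertices 4F = edge 1F 3F λ ()
  bvertices 5F = edge 2F 3F λ ()

-- Addition modulo N

module Cyclic (N-1 : ℕ) where
  N : ℕ
  N = suc N-1

  infixl 6 _⊕_ _⊖_
  _⊕_ _⊖_ : Fin N → Fin N → Fin N
  a ⊕ b = (toℕ a + toℕ b) mod N
  a ⊖ b = (toℕ a + (N ∸ toℕ b)) mod N

  toℕ-mod : ∀ m → toℕ (m mod N) ≡ m % N
  toℕ-mod m = toℕ-fromℕ< (m%n<n m N)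

  toℕ-⊕ : ∀ a b → toℕ (a ⊕ b) ≡ (toℕ a + toℕ b) % N
  toℕ-⊕ a b = toℕ-mod (toℕ a + toℕ b)

  toℕ-⊖ : ∀ a b → toℕ (a ⊖ b) ≡ (toℕ a + (N ∸ toℕ b)) % N
  toℕ-⊖ a b = toℕ-mod (toℕ a + (N ∸ toℕ b))

  ⊕-≡ : ∀ a b {c} → (toℕ a + toℕ b) % N ≡ toℕ c → a ⊕ b ≡ c
  ⊕-≡ a b eq = toℕ-injective (trans (toℕ-⊕ a b) eq)

  +%-absorb : ∀ m m′ → (m + m′ % N) % N ≡ (m + m′) % N
  +%-absorb m m′ = begin
    (m + m′ % N) % N           ≡⟨ %-distribˡ-+ m (m′ % N) N ⟩
    (m % N + m′ % N % N) % N   ≡⟨ cong (λ z → (m % N + z) % N) (m%n%n≡m%n m′ N) ⟩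
    (m % N + m′ % N) % N       ≡⟨ %-distribˡ-+ m m′ N ⟨
    (m + m′) % N               ∎
    where open ≡-Reasoning

  ⊕-comm : ∀ a b → a ⊕ b ≡ b ⊕ a
  ⊕-comm a b = cong (_mod N) (ℕ.+-comm (toℕ a) (toℕ b))

  cancel-period : ∀ a b → (toℕ a + (toℕ b + (N ∸ toℕ a))) % N ≡ toℕ b
  cancel-period a b = begin
    (toℕ a + (toℕ b + (N ∸ toℕ a))) % N  ≡⟨ cong (_% N) (ℕ.+-comm (toℕ a) _) ⟩
    (toℕ b + (N ∸ toℕ a) + toℕ a) % N    ≡⟨ cong (_% N) (ℕ.+-assoc (toℕ b) _ _) ⟩
    (toℕ b + (N ∸ toℕ a + toℕ a)) % N    ≡⟨ cong (λ z → (toℕ b + z) % N) (ℕ.m∸n+n≡m (ℕ.<⇒≤ (toℕ<n a))) ⟩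
    (toℕ b + N) % N                      ≡⟨ [m+n]%n≡m%n (toℕ b) N ⟩
    toℕ b % N                            ≡⟨ m<n⇒m%n≡m (toℕ<n b) ⟩
    toℕ b                                ∎
    where open ≡-Reasoning

  ⊕-⊖ : ∀ a b → a ⊕ (b ⊖ a) ≡ b
  ⊕-⊖ a b = ⊕-≡ a (b ⊖ a) (begin
    (toℕ a + toℕ (b ⊖ a)) % N                 ≡⟨ cong (λ z → (toℕ a + z) % N) (toℕ-⊖ b a) ⟩
    (toℕ a + (toℕ b + (N ∸ toℕ a)) % N) % N   ≡⟨ +%-absorb (toℕ a) _ ⟩
    (toℕ a + (toℕ b + (N ∸ toℕ a))) % N       ≡⟨ cancel-period a b ⟩
    toℕ b                                     ∎)
    where open ≡-Reasoning

  ⊖-⊕ : ∀ a b → (a ⊕ b) ⊖ a ≡ b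
  ⊖-⊕ a b = toℕ-injective (begin
    toℕ ((a ⊕ b) ⊖ a)             ≡⟨ toℕ-⊖ (a ⊕ b) a ⟩
    (toℕ (a ⊕ b) + c) % N         ≡⟨ cong (λ z → (z + c) % N) (toℕ-⊕ a b) ⟩
    ((toℕ a + toℕ b) % N + c) % N ≡⟨ cong (_% N) (ℕ.+-comm ((toℕ a + toℕ b) % N) c) ⟩
    (c + (toℕ a + toℕ b) % N) % N ≡⟨ +%-absorb c _ ⟩
    (c + (toℕ a + toℕ b)) % N     ≡⟨ cong (_% N) (ℕ.+-comm c _) ⟩
    (toℕ a + toℕ b + c) % N       ≡⟨ cong (_% N) (ℕ.+-assoc (toℕ a) _ c) ⟩
    (toℕ a + (toℕ b + c)) % N     ≡⟨ cancel-period a b ⟩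
    toℕ b                         ∎)
    where
    open ≡-Reasoning
    c = N ∸ toℕ a

  ⊕-cancelˡ : ∀ a {b c} → a ⊕ b ≡ a ⊕ c → b ≡ c
  ⊕-cancelˡ a {b} {c} eq = trans (sym (⊖-⊕ a b)) (trans (cong (_⊖ a) eq) (⊖-⊕ a c))

  ⊕-cancelʳ : ∀ c {a b} → a ⊕ c ≡ b ⊕ c → a ≡ b
  ⊕-cancelʳ c {a} {b} eq = ⊕-cancelˡ c (trans (⊕-comm c a) (trans eq (⊕-comm b c)))

  ⊕-identityʳ : ∀ a → a ⊕ zero ≡ a
  ⊕-identityʳ a = ⊕-≡ a zero (trans (cong (_% N) (ℕ.+-identityʳ (toℕ a))) (m<n⇒m%n≡m (toℕ<n a)))

-- The vertices of K (suc m) are identified with the residues modulo m + 3 other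
-- than 0 and 2. Since 0 + 2 = 1 + 1, no color class of the edge coloring
-- ρ p ⊕ ρ q is a perfect matching.

module Residues (m : ℕ) where
  open Cyclic (2 + m) public

  -- `punchIn 1F` skips 1; `suc` moves this gap to 2 and skips 0.
  ρ : Fin (suc m) → Fin N
  ρ p = suc (punchIn 1F p)

  ρ≢2 : ∀ p → ρ p ≢ 2F
  ρ≢2 p eq = punchInᵢ≢i 1F p (suc-injective eq)

  ρ-injective : ∀ {p q} → ρ p ≡ ρ q → p ≡ q
  ρ-injective eq = punchIn-injective 1F _ _ (suc-injective eq)

  ρ-onto : ∀ a → a ≢ 0F → a ≢ 2F → ∃ λ p → ρ p ≡ a
  ρ-onto zero    0≢0 _   = contradiction refl 0≢0
  ρ-onto (suc a) _   a≢2 = punchOut 1≢a , cong suc (punchIn-punchOut 1≢a)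
    where
    1≢a : 1F ≢ a
    1≢a 1≡a = a≢2 (cong suc (sym 1≡a))

  -- The part of the row of ρ p in the addition table not used by the edges at p.
  free : Fin (suc m) → Fin 3 → Fin N
  free p 0F = 0F
  free p 1F = 2F
  free p 2F = ρ p

  free-injective : ∀ p {a b} → free p a ≡ free p b → a ≡ b
  free-injective p {0F} {0F} eq = refl
  free-injective p {0F} {1F} ()
  free-injective p {0F} {2F} ()
  free-injective p {1F} {0F} ()
  free-injective p {2F} {0F} ()
  free-injective p {1F} {1F} eq = refl
  free-injective p {1F} {2F} eq = contradiction (sym eq) (ρ≢2 p)
  free-injective p {2F} {1F} eq = contradiction eq (ρ≢2 p)
  free-injective p {2F} {2F} eq = refl

  ρ≢free : ∀ {p q} a → p ≢ q → ρ q ≢ free p a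
  ρ≢free 1F _   = ρ≢2 _
  ρ≢free 2F p≢q eq = p≢q (sym (ρ-injective eq))

  -- Write `j` as `ρ p ⊕ b`: either `b` is the residue of another vertex or it is one of 0, 2 and
  -- `ρ p`.
  row : ∀ p j → (∃ λ q → p ≢ q × ρ p ⊕ ρ q ≡ j) ⊎ (∃ λ a → ρ p ⊕ free p a ≡ j)
  row p j with j ⊖ ρ p in eq | ⊕-⊖ (ρ p) j
  ... | b | p+b≡j with b ≟ 0F | b ≟ 2F | b ≟ ρ p
  ... | yes refl | _        | _        = inj₂ (0F , p+b≡j)
  ... | no  _    | yes refl | _        = inj₂ (1F , p+b≡j)
  ... | no  _    | no  _    | yes refl = inj₂ (2F , p+b≡j)
  ... | no b≢0   | no b≢2   | no b≢ρp with ρ-onto b b≢0 b≢2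
  ...   | q , refl = inj₁ (q , (λ p≡q → b≢ρp (cong ρ (sym p≡q))) , p+b≡j)

  -- The residue `N` - 2. It locates a vertex whose palette can contain 0, because -2 + 2 = 0.
  -2F : Fin N
  -2F = suc (inject₁ (fromℕ m))

  toℕ--2F : toℕ -2F ≡ suc m
  toℕ--2F = cong suc (trans (toℕ-inject₁ (fromℕ m)) (toℕ-fromℕ m))

  -2≢2 : m ≥ 2 → -2F ≢ 2F
  -2≢2 m≥2 eq = ℕ.<⇒≢ m≥2 (sym (ℕ.suc-injective (trans (sym toℕ--2F) (cong toℕ eq))))

  0⊕2≡2 : 0F ⊕ 2F ≡ 2F
  0⊕2≡2 = ⊕-≡ 0F 2F (m<n⇒m%n≡m {3 + m} {2} (s≤s (s≤s (s≤s z≤n))))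

  1⊕1≡2 : 1F ⊕ 1F ≡ 2F
  1⊕1≡2 = ⊕-≡ 1F 1F (m<n⇒m%n≡m {3 + m} {2} (s≤s (s≤s (s≤s z≤n))))

  -2⊕2≡0 : -2F ⊕ 2F ≡ 0F
  -2⊕2≡0 = ⊕-≡ -2F 2F (begin
    (toℕ -2F + 2) % N   ≡⟨ cong (λ z → (z + 2) % N) toℕ--2F ⟩
    (suc m + 2) % N     ≡⟨ cong (_% N) (ℕ.+-comm (suc m) 2) ⟩
    (0 + N) % N         ≡⟨ [m+n]%n≡m%n 0 N ⟩
    0 % N               ∎)
    where open ≡-Reasoning

-- Colorings for larger n

Kₙ-colorable₃ : ∀ {n t} (t>2 : t > 2) → n ≥ 3 → BColorable (C t t>2) 3 →
                BColorable (K n ⊡ C t t>2) (2 + n)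
Kₙ-colorable₃ {suc m} {t} t>2 (s≤s m≥2) (κ , κ-proper , κ-bvertices) = color , color-proper , bvertices
  where
  open Residues m
  open Palettes t>2 κ κ-proper (λ p q → ρ p ⊕ ρ q) (λ p q → ⊕-comm (ρ p) (ρ q))
    (λ p a → ρ p ⊕ free p a) (λ p → free-injective p ∘ ⊕-cancelˡ (ρ p))
    (λ {p} a p≢q → ρ≢free a p≢q ∘ ⊕-cancelˡ (ρ p))
  -- A residue `j` other than 0 and 2 is free at its own vertex as `j` + 0. The color 2 is 1 + 1 at
  -- the vertex of residue 1, and 0 is -2 + 2.
  covered : ∀ j → ∃₂ λ p a → ρ p ⊕ free p a ≡ j
  covered j with j ≟ 0F | j ≟ 2F
  ... | no j≢0 | no j≢2 with ρ-onto j j≢0 j≢2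
  ...   | p , ρp≡j = p , 0F , trans (⊕-identityʳ (ρ p)) ρp≡j
  covered j | _ | yes refl = 0F , 2F , 1⊕1≡2
  covered j | yes refl | no _ with ρ-onto -2F (λ ()) (-2≢2 m≥2)
  ...   | p , ρp≡-2 = p , 1F , trans (cong (_⊕ 2F) ρp≡-2) -2⊕2≡0
  bvertices : ∀ j → ∃ λ v → color v ≡ j × BVertex (K (suc m) ⊡ C t t>2) color v
  bvertices j with covered j
  ... | p , a , refl with κ-bvertices a
  ...   | h , refl , h-bvertex = inj₂ (p , h) , refl , copy-bvertex p h h-bvertex (row p)

-- Palettes now have two colors. The vertices other than `zero` carry residues, and the edge from
-- such a vertex to `zero` uses up the third free color of its row. All b-vertices are taken in the
-- copies at vertices with residues.
Kₙ-colorable₂ : ∀ {n t} (t>2 : t > 2) → n ≥ 6 → BColorable (C t t>2) 2 →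
                BColorable (K n ⊡ C t t>2) (1 + n)
Kₙ-colorable₂ {suc (suc m@(suc (suc m′)))} {t} t>2 (s≤s (s≤s (s≤s (s≤s m′≥2))))
  (κ , κ-proper , κ-bvertices) = color , color-proper , bvertices
  where
  open Residues m
  -- The edge joining the residue of p to the additional vertex zero takes the free
  -- color ρ p + 2, except that −2 takes −4, so that 0 remains available at −2.
  link spare : {P : Set} → Dec P → Fin 3
  link  (yes _) = 2F
  link  (no _)  = 1F
  spare (yes _) = 1F
  spare (no _)  = 2F
  free-role : {P : Set} (d : Dec P) → ∀ a → a ≡ 0F ⊎ a ≡ link d ⊎ a ≡ spare d
  free-role _       0F = inj₁ refl
  free-role (yes _) 1F = inj₂ (inj₂ refl)
  free-role (yes _) 2F = inj₂ (inj₁ refl)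
  free-role (no _)  1F = inj₂ (inj₁ refl)
  free-role (no _)  2F = inj₂ (inj₂ refl)
  link≢spare : {P : Set} (d : Dec P) → link d ≢ spare d
  link≢spare (yes _) ()
  link≢spare (no _)  ()
  0≢link : {P : Set} (d : Dec P) → 0F ≢ link d
  0≢link (yes _) ()
  0≢link (no _)  ()
  0≢spare : {P : Set} (d : Dec P) → 0F ≢ spare d
  0≢spare (yes _) ()
  0≢spare (no _)  ()
  special? : ∀ p → Dec (ρ p ≡ -2F)
  special? p = ρ p ≟ -2F

  -- Here `N` is `m′` + 5, so -4 is `m′` + 1; `m′≥2` keeps it away from 2.
  toℕ--4 : toℕ (-2F ⊕ -2F) ≡ suc m′
  toℕ--4 = begin
    toℕ (-2F ⊕ -2F)            ≡⟨ toℕ-⊕ -2F -2F ⟩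
    (toℕ -2F + toℕ -2F) % N    ≡⟨ cong (λ z → (z + z) % N) toℕ--2F ⟩
    (3 + m′ + (3 + m′)) % N    ≡⟨ cong (λ z → suc z % N) (sym (trans (ℕ.+-suc m′ (4 + m′)) (cong suc (ℕ.+-suc m′ (3 + m′))))) ⟩
    (suc m′ + N) % N           ≡⟨ [m+n]%n≡m%n (suc m′) N ⟩
    suc m′ % N                 ≡⟨ m<n⇒m%n≡m (s≤s (s≤s (ℕ.m≤n+m m′ 3))) ⟩
    suc m′                     ∎
    where open ≡-Reasoning
  -4≢0 : -2F ⊕ -2F ≢ 0F
  -4≢0 eq = case trans (sym toℕ--4) (cong toℕ eq) of λ ()
  -4≢2 : -2F ⊕ -2F ≢ 2F
  -4≢2 eq = ℕ.<⇒≢ m′≥2 (sym (ℕ.suc-injective (trans (sym toℕ--4) (cong toℕ eq))))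

  linkColor : Fin (suc m) → Fin N
  linkColor p = ρ p ⊕ free p (link (special? p))
  linkColor≢0 : ∀ p → linkColor p ≢ 0F
  linkColor≢0 p eq with special? p
  ... | yes ρp≡-2 = -4≢0 (trans (sym (cong₂ _⊕_ ρp≡-2 ρp≡-2)) eq)
  ... | no  ρp≢-2 = ρp≢-2 (⊕-cancelʳ 2F (trans eq (sym -2⊕2≡0)))
  linkColor≢2 : ∀ p → linkColor p ≢ 2F
  linkColor≢2 p eq with special? p
  ... | yes ρp≡-2 = -4≢2 (trans (sym (cong₂ _⊕_ ρp≡-2 ρp≡-2)) eq)
  ... | no  _     with ⊕-cancelʳ 2F {ρ p} {0F} (trans eq (sym 0⊕2≡2))
  ...   | ()

  ε : Fin (2 + m) → Fin (2 + m) → Fin N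
  ε zero    zero    = zero
  ε zero    (suc q) = linkColor q
  ε (suc p) zero    = linkColor p
  ε (suc p) (suc q) = ρ p ⊕ ρ q
  ε-sym : ∀ p q → ε p q ≡ ε q p
  ε-sym zero    zero    = refl
  ε-sym zero    (suc _) = refl
  ε-sym (suc _) zero    = refl
  ε-sym (suc p) (suc q) = ⊕-comm (ρ p) (ρ q)

  π : Fin (2 + m) → Fin 2 → Fin N
  -- 0 and 2 are colors that no edge at `zero` takes.
  π zero    0F = 0F
  π zero    1F = 2F
  π (suc p) 0F = ρ p ⊕ free p 0F
  π (suc p) 1F = ρ p ⊕ free p (spare (special? p))
  π-injective : ∀ p {a b} → π p a ≡ π p b → a ≡ b
  π-injective _       {0F} {0F} _  = refl
  π-injective _       {1F} {1F} _  = refl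
  π-injective zero    {0F} {1F} ()
  π-injective zero    {1F} {0F} ()
  π-injective (suc p) {0F} {1F} eq = contradiction
    (free-injective p (⊕-cancelˡ (ρ p) eq)) (0≢spare (special? p))
  π-injective (suc p) {1F} {0F} eq = contradiction
    (free-injective p (⊕-cancelˡ (ρ p) (sym eq))) (0≢spare (special? p))

  ε≢π : ∀ {p q} a → p ≢ q → ε p q ≢ π p a
  ε≢π {zero}  {zero}  _  0≢0 _  = 0≢0 refl
  ε≢π {zero}  {suc q} 0F _   eq = linkColor≢0 q eq
  ε≢π {zero}  {suc q} 1F _   eq = linkColor≢2 q eq
  ε≢π {suc p} {zero}  0F _   eq = 0≢link (special? p) (sym (free-injective p (⊕-cancelˡ (ρ p) eq)))
  ε≢π {suc p} {zero}  1F _   eq = link≢spare (special? p) (free-injective p (⊕-cancelˡ (ρ p) eq))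
  ε≢π {suc p} {suc q} 0F p≢q eq = ρ≢free 0F (p≢q ∘ cong suc) (⊕-cancelˡ (ρ p) eq)
  ε≢π {suc p} {suc q} 1F p≢q eq =
    ρ≢free (spare (special? p)) (p≢q ∘ cong suc) (⊕-cancelˡ (ρ p) eq)

  open Palettes t>2 κ κ-proper ε ε-sym π π-injective ε≢π

  seen : ∀ p j → (∃ λ q → suc p ≢ q × ε (suc p) q ≡ j) ⊎ (∃ λ a → π (suc p) a ≡ j)
  seen p j with row p j
  ... | inj₁ (q , p≢q , eq) = inj₁ (suc q , p≢q ∘ suc-injective , eq)
  ... | inj₂ (a , eq) with free-role (special? p) a
  ...   | inj₁ refl        = inj₂ (0F , eq)
  ...   | inj₂ (inj₁ refl) = inj₁ (zero , (λ ()) , eq)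
  ...   | inj₂ (inj₂ refl) = inj₂ (1F , eq)

  covered : ∀ j → ∃₂ λ p a → π (suc p) a ≡ j
  covered j with j ≟ 0F | j ≟ 2F
  ... | no j≢0 | no j≢2 with ρ-onto j j≢0 j≢2
  ...   | p , ρp≡j = p , 0F , trans (⊕-identityʳ (ρ p)) ρp≡j
  covered j | _ | yes refl = 0F , 1F , 1⊕1≡2
  covered j | yes refl | no _ with ρ-onto -2F (λ ()) (-2≢2 (s≤s (s≤s z≤n)))
  ...   | p , ρp≡-2 = p , 1F , (begin
    ρ p ⊕ free p (spare (special? p)) ≡⟨ cong (λ a → ρ p ⊕ free p a) (is-special p ρp≡-2) ⟩
    ρ p ⊕ 2F                          ≡⟨ cong (_⊕ 2F) ρp≡-2 ⟩
    -2F ⊕ 2F                          ≡⟨ -2⊕2≡0 ⟩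
    0F                                ∎)
    where
    open ≡-Reasoning
    is-special : ∀ p → ρ p ≡ -2F → spare (special? p) ≡ 1F
    is-special p ρp≡-2 with special? p
    ... | yes _     = refl
    ... | no  ρp≢-2 = contradiction ρp≡-2 ρp≢-2

  bvertices : ∀ j → ∃ λ v → color v ≡ j × BVertex (K (2 + m) ⊡ C t t>2) color v
  bvertices j with covered j
  ... | p , a , refl with κ-bvertices a
  ...   | h , refl , h-bvertex = inj₂ (suc p , h) , refl , copy-bvertex (suc p) h h-bvertex (seen p)

-- Upper bounds

-- The source of all degree bounds: a list `ν` covering the closed neighborhood of a b-vertex shows
-- every color, so it has at least k entries, and no color twice if it has exactly k.
closed-neighborhood-onto : ∀ (G : Graph) {k d} (c : Graph.V G → Fin k) {v} (ν : Fin d → Graph.V G) →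
  (∃ λ i → ν i ≡ v) → (∀ w → Graph._~_ G v w → ∃ λ i → ν i ≡ w) →
  BVertex G c v → Onto (c ∘ ν)
closed-neighborhood-onto G c {v} ν (i , refl) cover v-bvertex j with j ≟ c v
... | yes j≡ = i , sym j≡
... | no  j≢ with v-bvertex j j≢
...   | w , v~w , cw≡j with cover w v~w
...     | i′ , refl = i′ , cw≡j

C-neighbors : ∀ {t} (t>2 : t > 2) (h : Fin t) →
  ∃₂ λ a b → ∀ h′ → Graph._~_ (C t t>2) h h′ → h′ ≡ a ⊎ h′ ≡ b
C-neighbors {t} t>2 h with any? (next? h) | any? (λ h′ → next? h′ h)
... | after | before = pick after , pick before , λ where
    h′ (inj₁ h→h′) → inj₁ (unique after next-functional h′ h→h′)
    h′ (inj₂ h′→h) → inj₂ (unique before next-injective h′ h′→h)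
  where
  -- The default `h` avoids proving that a successor or predecessor exists: if there were none,
  -- there would be nothing to cover.
  pick : {P : Fin t → Set} → Dec (∃ P) → Fin t
  pick (yes (a , _)) = a
  pick (no _)        = h
  unique : {P : Fin t → Set} (d : Dec (∃ P)) → (∀ {i j} → P i → P j → i ≡ j) → ∀ i → P i → i ≡ pick d
  unique (yes (_ , pa)) functional i pi = functional pi pa
  unique (no none)      _          i pi = contradiction (i , pi) none
  next-functional : ∀ {i j} → Next h i → Next h j → i ≡ j
  next-functional {i} {j} (inj₁ i≡)       (inj₁ j≡)       = toℕ-injective (trans i≡ (sym j≡))
  next-functional {i} {j} (inj₁ i≡)       (inj₂ (h≡t , _)) = contradiction (trans i≡ h≡t) (ℕ.<⇒≢ (toℕ<n i))
  next-functional {i} {j} (inj₂ (h≡t , _)) (inj₁ j≡)       = contradiction (trans j≡ h≡t) (ℕ.<⇒≢ (toℕ<n j))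
  next-functional {i} {j} (inj₂ (_ , i≡)) (inj₂ (_ , j≡)) = toℕ-injective (trans i≡ (sym j≡))
  next-injective : ∀ {i j} → Next i h → Next j h → i ≡ j
  next-injective {i} {j} (inj₁ h≡)       (inj₁ h≡′)       = toℕ-injective (ℕ.suc-injective (trans (sym h≡) h≡′))
  next-injective {i} {j} (inj₁ h≡)       (inj₂ (_ , h≡0)) = case trans (sym h≡) h≡0 of λ ()
  next-injective {i} {j} (inj₂ (_ , h≡0)) (inj₁ h≡)       = case trans (sym h≡) h≡0 of λ ()
  next-injective {i} {j} (inj₂ (i≡ , _)) (inj₂ (j≡ , _)) = toℕ-injective (ℕ.suc-injective (trans i≡ (sym j≡)))

module Neighborhoods {n t : ℕ} (t>2 : t > 2) where
  open Graph (K n ⊡ C t t>2) using (V; _~_)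
  open Graph (K n) using (Edge; _∈ₑ_)

  -- The edges at p, indexed by their other ends, with x at the unused index p.
  star : Fin n → V → Fin n → V
  star p x q with p ≟ q
  ... | yes _   = x
  ... | no  p≢q = inj₁ (inj₂ (proj₁ (join p≢q)))

  star-self : ∀ p x → ∃ λ q → star p x q ≡ x
  star-self p x = p , eq
    where
    eq : star p x p ≡ x
    eq with p ≟ p
    ... | yes _   = refl
    ... | no  p≢p = contradiction refl p≢p

  star-edge : ∀ {p} x (e : Edge) → p ∈ₑ e → ∃ λ q → star p x q ≡ inj₁ (inj₂ e)
  star-edge {p} x e p∈e with other-end e p∈e
  ... | q , p≢q , q∈e = q , eq
    where
    eq : star p x q ≡ inj₁ (inj₂ e)
    eq with p ≟ q
    ... | yes p≡q = contradiction p≡q p≢q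
    ... | no  p≢q with join p≢q
    ...   | e′ , p∈e′ , q∈e′ = cong (inj₁ ∘ inj₂) (edge-unique e′ e p≢q p∈e′ q∈e′ p∈e q∈e)

  around-copy : Fin n → Fin t → Fin t → Fin t → Fin (2 + n) → V
  around-copy p h a b zero          = inj₂ (p , a)
  around-copy p h a b (suc zero)    = inj₂ (p , b)
  around-copy p h a b (suc (suc q)) = star p (inj₂ (p , h)) q

  -- The neighbors of an edge vertex on the side of its end `p`.
  hub : Fin n → Fin (suc t) → V
  hub p zero    = inj₁ (inj₁ p)
  hub p (suc h) = inj₂ (p , h)

  end : Edge → Fin 2 → Fin n
  end ((p , _) , _) zero    = p
  end ((_ , q) , _) (suc _) = q

  ∈ₑ⇒end : ∀ {p} (e : Edge) → p ∈ₑ e → ∃ λ s → end e s ≡ p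
  ∈ₑ⇒end e (inj₁ refl) = zero , refl
  ∈ₑ⇒end e (inj₂ refl) = suc zero , refl

  around-edge : Edge → Fin (1 + 2 * suc t) → V
  around-edge e zero    = inj₁ (inj₂ e)
  around-edge e (suc i) = hub (end e (proj₁ (remQuot {2} (suc t) i))) (proj₂ (remQuot {2} (suc t) i))

  around-edge-hub : ∀ {p} (e : Edge) → p ∈ₑ e → ∀ b → ∃ λ i → around-edge e i ≡ hub p b
  around-edge-hub e p∈e b with ∈ₑ⇒end e p∈e
  ... | s , refl = suc (combine s b) ,
    cong (λ (s , b) → hub (end e s) b) (remQuot-combine {2} {suc t} s b)

  module _ {k : ℕ} (c : V → Fin k) where

    vertex-onto : ∀ {p} → BVertex (K n ⊡ C t t>2) c (inj₁ (inj₁ p)) →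
                  Onto (c ∘ star p (inj₁ (inj₁ p)))
    vertex-onto {p} = closed-neighborhood-onto (K n ⊡ C t t>2) c (star p x) (star-self p x) λ where
        (inj₁ (inj₂ e)) p∈e → star-edge x e p∈e
      where x = inj₁ (inj₁ p)

    copy-onto : ∀ {p h a b} → (∀ h′ → Graph._~_ (C t t>2) h h′ → h′ ≡ a ⊎ h′ ≡ b) →
                BVertex (K n ⊡ C t t>2) c (inj₂ (p , h)) → Onto (c ∘ around-copy p h a b)
    copy-onto {p} {h} {a} {b} h-neighbors =
      closed-neighborhood-onto (K n ⊡ C t t>2) c (around-copy p h a b) (shift (star-self p x)) λ where
        (inj₁ (inj₂ e)) p∈e → shift (star-edge x e p∈e)
        (inj₂ (_ , h′)) (refl , h~h′) → in-copy (h-neighbors h′ h~h′)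
      where
      x = inj₂ (p , h)
      shift : ∀ {w} → (∃ λ q → star p x q ≡ w) → ∃ λ i → around-copy p h a b i ≡ w
      shift (q , eq) = suc (suc q) , eq
      in-copy : ∀ {h′} → h′ ≡ a ⊎ h′ ≡ b → ∃ λ i → around-copy p h a b i ≡ inj₂ (p , h′)
      in-copy (inj₁ refl) = zero , refl
      in-copy (inj₂ refl) = suc zero , refl

    edge-onto : ∀ {e} → BVertex (K n ⊡ C t t>2) c (inj₁ (inj₂ e)) → Onto (c ∘ around-edge e)
    edge-onto {e} = closed-neighborhood-onto (K n ⊡ C t t>2) c (around-edge e) (zero , refl) λ where
        (inj₁ (inj₁ p)) p∈e → around-edge-hub e p∈e zero
        (inj₂ (p , h))  p∈e → around-edge-hub e p∈e (suc h)

    bvertex⇒edge : k > 2 + n → ∀ {v} → BVertex (K n ⊡ C t t>2) c v → ∃ λ e → v ≡ inj₁ (inj₂ e)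
    bvertex⇒edge k> {inj₁ (inj₁ p)} bv =
      contradiction (ℕ.≤-trans (onto⇒≥ (vertex-onto bv)) (ℕ.m≤n+m n 2)) (ℕ.<⇒≱ k>)
    bvertex⇒edge k> {inj₁ (inj₂ e)} bv = e , refl
    bvertex⇒edge k> {inj₂ (p , h)} bv =
      contradiction (onto⇒≥ (copy-onto (proj₂ (proj₂ (C-neighbors t>2 h))) bv)) (ℕ.<⇒≱ k>)

-- Beyond n + 2 colors only edge vertices can be b-vertices. Either their closed neighborhoods, with
-- 2t + 3 ≤ n + 2 vertices, are too small, or there are fewer edges than colors.
bcolorable⇒≤ : ∀ {n t} (t>2 : t > 2) →
  n ≥ 2 * t + 1 ⊎ proj₁ (Graph.Edge-finite (K n)) ≤ 2 + n →
  ∀ l → BColorable (K n ⊡ C t t>2) l → l ≤ 2 + n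
bcolorable⇒≤ {n} {t} t>2 bound l (c , _ , bvertices) = ℕ.≮⇒≥ (too-many bound)
  where
  open Neighborhoods {n} t>2
  too-many : n ≥ 2 * t + 1 ⊎ proj₁ (Graph.Edge-finite (K n)) ≤ 2 + n → ¬ (2 + n ℕ.< l)
  too-many (inj₁ n≥) l> with bvertices (fromℕ< l>)
  ... | v , _ , bv with bvertex⇒edge c l> bv
  ...   | e , refl = ℕ.<⇒≱ l> (ℕ.≤-trans (onto⇒≥ (edge-onto c bv)) (begin
    1 + 2 * suc t    ≡⟨ cong suc (ℕ.*-suc 2 t) ⟩
    3 + 2 * t        ≡⟨ cong (2 +_) (ℕ.+-comm 1 (2 * t)) ⟩
    2 + (2 * t + 1)  ≤⟨ ℕ.+-monoʳ-≤ 2 n≥ ⟩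
    2 + n            ∎))
    where open ℕ.≤-Reasoning
  too-many (inj₂ |E|≤) l> = ℕ.<⇒≱ l> (ℕ.≤-trans (onto⇒≥ onto) |E|≤)
    where
    open Inverse (proj₂ (Graph.Edge-finite (K n)))
    onto : Onto (c ∘ inj₁ ∘ inj₂ ∘ from)
    onto j with bvertices j
    ... | v , cv≡j , bv with bvertex⇒edge c l> bv
    ...   | e , refl = to e , trans (cong (c ∘ inj₁ ∘ inj₂) (strictlyInverseʳ e)) cv≡j

-- The case t = 4

module FourCycle {n : ℕ} (4>2 : 4 > 2)
  (c : Graph.V (K n ⊡ C 4 4>2) → Fin (2 + n)) (c-proper : Proper (K n ⊡ C 4 4>2) c) where
  open Neighborhoods {n} 4>2
  open Graph (C 4 4>2) using () renaming (_~_ to _~ₜ_; _~?_ to _~ₜ?_)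

  opposite : Fin 4 → Fin 4
  opposite 0F = 2F
  opposite 1F = 3F
  opposite 2F = 0F
  opposite 3F = 1F

  neighbor : Fin 4 → Fin 4
  neighbor 0F = 1F
  neighbor 1F = 0F
  neighbor 2F = 1F
  neighbor 3F = 0F

  ~-opposite : ∀ h h′ → h ~ₜ h′ → opposite h ~ₜ h′
  ~-opposite = from-yes (all? λ h → all? λ h′ → (h ~ₜ? h′) →-dec (opposite h ~ₜ? h′))

  neighbors : ∀ h h′ → h ~ₜ h′ → h′ ≡ neighbor h ⊎ h′ ≡ opposite (neighbor h)
  neighbors = from-yes (all? λ h → all? λ h′ →
    (h ~ₜ? h′) →-dec ((h′ ≟ neighbor h) ⊎-dec (h′ ≟ opposite (neighbor h))))

  at : Fin n → Fin 4 → Fin (2 + n)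
  at p h = c (inj₂ (p , h))

  -- Opposite vertices have the same neighbors, so the color of `opposite h` cannot occur next to
  -- `h`; a b-vertex misses no color but its own.
  opposite-color : ∀ {p h} → BVertex (K n ⊡ C 4 4>2) c (inj₂ (p , h)) → at p h ≡ at p (opposite h)
  opposite-color {p} {h} bv with at p (opposite h) ≟ at p h
  ... | yes same = sym same
  ... | no  differ with bv _ differ
  ...   | inj₁ (inj₂ e) , p∈e , eq =
    contradiction eq (c-proper (inj₁ (inj₂ e)) (inj₂ (p , opposite h)) p∈e)
  ...   | inj₂ (_ , h′) , (refl , h~h′) , eq =
    contradiction (sym eq) (c-proper (inj₂ (p , opposite h)) (inj₂ (p , h′)) (refl , ~-opposite h h′ h~h′))

  -- The closed neighborhood is listed with n + 2 entries and shows n + 2 colors, so its entries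
  -- have distinct colors.
  neighbor-colors : ∀ {p h} → BVertex (K n ⊡ C 4 4>2) c (inj₂ (p , h)) →
                    at p (neighbor h) ≢ at p (opposite (neighbor h))
  neighbor-colors {h = h} bv eq =
    case onto⇒injective (copy-onto c (neighbors h) bv) {0F} {1F} eq of λ ()

  hub-sum : Fin n → (Fin (2 + n) → Bool) → Bool
  hub-sum p x = sum (x ∘ c ∘ hub p)

  Diagonals : Fin n → Set
  Diagonals p = Dec (at p 0F ≡ at p 2F) × Dec (at p 1F ≡ at p 3F)

  diagonals : ∀ p → Diagonals p
  diagonals p = (at p 0F ≟ at p 2F) , (at p 1F ≟ at p 3F)

  -- The coordinate of the only color that b-vertices in the copy at `p` can have. If both diagonals
  -- are monochromatic there are no such b-vertices and either coordinate will do; if neither is,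
  -- there are none either, and the form is free to serve the edges at `p`.
  measure : ∀ p → Diagonals p → (Fin (2 + n) → Bool) → Bool
  measure p (yes _ , _)    x = x (at p 0F)
  measure p (no _ , yes _) x = x (at p 1F)
  measure p (no _ , no _)  x = hub-sum p x

  copy-measured : ∀ {p} h → BVertex (K n ⊡ C 4 4>2) c (inj₂ (p , h)) →
                  ∀ d x → x (at p h) ≡ measure p d x
  copy-measured 0F bv (yes _ , _)      x = refl
  copy-measured 0F bv (no differ , _)       x = contradiction (opposite-color bv) differ
  copy-measured 1F bv (yes same , _)      x = contradiction same (neighbor-colors bv)
  copy-measured 1F bv (no _ , yes _)   x = refl
  copy-measured 1F bv (no _ , no differ)    x = contradiction (opposite-color bv) differ
  copy-measured 2F bv (yes same , _)      x = cong x (sym same)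
  copy-measured 2F bv (no differ , _)       x = contradiction (sym (opposite-color bv)) differ
  copy-measured 3F bv (yes same , _)      x = contradiction same (neighbor-colors bv)
  copy-measured 3F bv (no _ , yes same)   x = cong x (sym same)
  copy-measured 3F bv (no _ , no differ)    x = contradiction (sym (opposite-color bv)) differ

  -- A linear form base together with the n measures would determine all n + 2
  -- coordinates of a vector x over 𝔽₂.
  not-separated : ∀ (base : (Fin (2 + n) → Bool) → Bool) →
    (∀ j → ∃ λ v → c v ≡ j × BVertex (K n ⊡ C 4 4>2) c v) →
    ¬ (∀ e → BVertex (K n ⊡ C 4 4>2) c (inj₁ (inj₂ e)) → ∀ x y → base x ≡ base y →
       (∀ p → measure p (diagonals p) x ≡ measure p (diagonals p) y) →
       x (c (inj₁ (inj₂ e))) ≡ y (c (inj₁ (inj₂ e))))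
  not-separated base bvertices edge-measured =
    ℕ.1+n≰n (separating⇒≤ {m = suc n} evaluate separating)
    where
    evaluate : Fin (suc n) → (Fin (2 + n) → Bool) → Bool
    evaluate zero    = base
    evaluate (suc p) = measure p (diagonals p)
    separating : ∀ x y → (∀ i → evaluate i x ≡ evaluate i y) → x ≗ y
    separating x y same j with bvertices j
    ... | inj₁ (inj₁ p) , refl , bv =
      contradiction (ℕ.≤-trans (onto⇒≥ (vertex-onto c bv)) (ℕ.m≤n+m n 1)) ℕ.1+n≰n
    ... | inj₁ (inj₂ e) , refl , bv = edge-measured e bv x y (same zero) (same ∘ suc)
    ... | inj₂ (p , h)  , refl , bv =
      trans (copy-measured h bv (diagonals p) x) (trans (same (suc p)) (sym (copy-measured h bv (diagonals p) y)))

¬K₂⊡C₄-4-colorable : (4>2 : 4 > 2) → ¬ BColorable (K 2 ⊡ C 4 4>2) 4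
¬K₂⊡C₄-4-colorable 4>2 (c , c-proper , bvertices) =
  -- The extra form reads the coordinate of the color of the single edge.
  not-separated (λ x → x (c (inj₁ (inj₂ e₀)))) bvertices
    λ e _ x y same _ → subst (λ e → x (c (inj₁ (inj₂ e))) ≡ y (c (inj₁ (inj₂ e)))) (unique e₀ e) same
  where
  open FourCycle {2} 4>2 c c-proper
  open Graph (K 2) using (Edge; Edge-finite)
  open Inverse (proj₂ Edge-finite)
  e₀ : Edge
  e₀ = from 0F
  Fin-1-unique : (i j : Fin 1) → i ≡ j
  Fin-1-unique 0F 0F = refl
  unique : ∀ e e′ → e ≡ e′
  unique e e′ = trans (sym (strictlyInverseʳ e))
    (trans (cong from (Fin-1-unique (to e) (to e′))) (strictlyInverseʳ e′))

sum-++ : ∀ m {l} (f : Fin (m + l) → Bool) → sum f ≡ sum (f ∘ (_↑ˡ l)) xor sum (f ∘ (m ↑ʳ_))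
sum-++ zero    f = refl
sum-++ (suc m) f = trans (cong (f zero xor_) (sum-++ m (f ∘ suc))) (sym (xor-assoc (f zero) _ _))

-- For a b-vertex e = p q the closed neighborhood of e carries every color exactly
-- once, so x (c e) is the sum of all of x minus the sums over the hubs of p and q.
¬K₉⊡C₄-11-colorable : (4>2 : 4 > 2) → ¬ BColorable (K 9 ⊡ C 4 4>2) 11
¬K₉⊡C₄-11-colorable 4>2 (c , c-proper , bvertices) = not-separated sum bvertices edge-measured
  where
  open FourCycle {9} 4>2 c c-proper
  open Neighborhoods {9} 4>2
  open Graph (K 9) using (Edge)

  BEdge : Edge → Set
  BEdge e = BVertex (K 9 ⊡ C 4 4>2) c (inj₁ (inj₂ e))

  -- An edge vertex has a closed neighborhood of 1 + 2 * 5 = 11 vertices, exactly the number of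
  -- colors.
  hub-injective : ∀ {e} → BEdge e → ∀ s {i j} →
    c (hub (end e s) i) ≡ c (hub (end e s) j) → i ≡ j
  hub-injective {e} bv s {i} {j} eq = proj₂ (combine-injective s i s j (suc-injective
    (onto⇒injective (edge-onto c bv) (trans (here i) (trans eq (sym (here j)))))))
    where
    here : ∀ i → c (around-edge e (suc (combine s i))) ≡ c (hub (end e s) i)
    here i = cong (λ (s , b) → c (hub (end e s) b)) (remQuot-combine {2} {5} s i)

  end-measure : ∀ {e} → BEdge e → ∀ s d x → measure (end e s) d x ≡ hub-sum (end e s) x
  -- Hub indices are cycle positions shifted by one, since index 0 is the vertex of `K 9` itself.
  end-measure bv s (yes same , _)    x = case hub-injective bv s {1F} {3F} same of λ ()
  end-measure bv s (no _ , yes same) x = case hub-injective bv s {2F} {4F} same of λ ()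
  end-measure bv s (no _ , no _)  x = refl

  edge-measured : ∀ e → BEdge e → ∀ x y → sum x ≡ sum y →
    (∀ p → measure p (diagonals p) x ≡ measure p (diagonals p) y) →
    x (c (inj₁ (inj₂ e))) ≡ y (c (inj₁ (inj₂ e)))
  edge-measured e bv x y total same = begin
    x (c (inj₁ (inj₂ e)))               ≡⟨ decode x ⟩
    sum x xor hubs x                    ≡⟨ cong₂ _xor_ total (cong₂ _xor_ (same-hub 0F) (same-hub 1F)) ⟩
    sum y xor hubs y                    ≡⟨ decode y ⟨
    y (c (inj₁ (inj₂ e)))               ∎
    where
    open ≡-Reasoning
    hubs : (Fin 11 → Bool) → Bool
    hubs x = hub-sum (end e 0F) x xor hub-sum (end e 1F) x
    same-hub : ∀ s → hub-sum (end e s) x ≡ hub-sum (end e s) y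
    same-hub s = trans (sym (end-measure bv s (diagonals _) x))
      (trans (same (end e s)) (end-measure bv s (diagonals _) y))
    decode : ∀ x → x (c (inj₁ (inj₂ e))) ≡ sum x xor hubs x
    decode x = begin
      x (c (inj₁ (inj₂ e)))                         ≡⟨ xor-identityʳ _ ⟨
      x (c (inj₁ (inj₂ e))) xor false               ≡⟨ cong (x (c (inj₁ (inj₂ e))) xor_) (xor-same (hubs x)) ⟨
      x (c (inj₁ (inj₂ e))) xor (hubs x xor hubs x) ≡⟨ xor-assoc (x (c (inj₁ (inj₂ e)))) (hubs x) (hubs x) ⟨
      -- `remQuot` computes on the ten indices, so the two halves are the hubs at the two ends.
      (x (c (inj₁ (inj₂ e))) xor hubs x) xor hubs x ≡⟨ cong (λ z → (x (c (inj₁ (inj₂ e))) xor z) xor hubs x)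
                                                         (sum-++ 5 (x ∘ c ∘ around-edge e ∘ suc)) ⟨
      -- Reading the colors around `e` permutes the 11 coordinates of `x`.
      sum (x ∘ c ∘ around-edge e) xor hubs x        ≡⟨ cong (_xor hubs x) (sum-permute x (onto⇒permutation (edge-onto c bv))) ⟨
      sum x xor hubs x                              ∎

¬Kₙ⊡C₄-colorable : ∀ {n} (4>2 : 4 > 2) → n ≥ 9 → ¬ BColorable (K n ⊡ C 4 4>2) (2 + n)
¬Kₙ⊡C₄-colorable {n} 4>2 n≥9 colorable with ℕ.m≤n⇒m<n∨m≡n n≥9
... | inj₂ refl = ¬K₉⊡C₄-11-colorable 4>2 colorable
-- Now 11 < n + 2, so no edge vertex is a b-vertex and a constant extra form suffices.
... | inj₁ n>9 = not-separated (λ _ → false) bvertices λ e bv →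
    contradiction (onto⇒≥ (edge-onto c bv)) (ℕ.<⇒≱ (s≤s (s≤s n>9)))
  where
  c = proj₁ colorable
  bvertices = proj₂ (proj₂ colorable)
  open FourCycle {n} 4>2 c (proj₁ (proj₂ colorable))
  open Neighborhoods {n} 4>2

theorem21 : (n t : ℕ) → n > 1 → (t>2 : t > 2) →
    (((n ≡ 2 × t ≡ 4) ⊎ (n ≥ 9 × t ≡ 4)) →
    φ[ K n ⊡ C t t>2 ]≡ (n + 1))
    ×
    (((n ≡ 2 × t ≢ 4) ⊎ (n ≡ 3 ⊎ n ≡ 4) ⊎ (n ≥ 2 * t + 1 × t ≢ 4)) →
    φ[ K n ⊡ C t t>2 ]≡ (n + 2))
theorem21 n t _ t>2 rewrite ℕ.+-comm n 1 | ℕ.+-comm n 2 = n+1-colors , n+2-colors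
  where
  -- The number of edges computes to 1, 3 and 6 for m = 2, 3 and 4, against 4, 5 and 6 colors.
  few-edges : ∀ {m} → proj₁ (Graph.Edge-finite (K m)) ≤ 2 + m →
              ∀ l → BColorable (K m ⊡ C t t>2) l → l ≤ 2 + m
  few-edges = bcolorable⇒≤ t>2 ∘ inj₂

  sharpen : ¬ BColorable (K n ⊡ C t t>2) (2 + n) →
            (∀ l → BColorable (K n ⊡ C t t>2) l → l ≤ 2 + n) →
            ∀ l → BColorable (K n ⊡ C t t>2) l → l ≤ 1 + n
  sharpen excluded bound l colorable = ℕ.≤-pred (ℕ.≤∧≢⇒< (bound l colorable)
    λ l≡2+n → excluded (subst (BColorable (K n ⊡ C t t>2)) l≡2+n colorable))

  n+1-colors : (n ≡ 2 × t ≡ 4) ⊎ (n ≥ 9 × t ≡ 4) → φ[ K n ⊡ C t t>2 ]≡ (1 + n)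
  n+1-colors (inj₁ (refl , refl)) =
    K₂-colorable t>2 (C₄-2-colorable t>2) ,
    sharpen (¬K₂⊡C₄-4-colorable t>2) (few-edges (s≤s z≤n))
  n+1-colors (inj₂ (n≥9 , refl)) =
    Kₙ-colorable₂ t>2 (ℕ.≤-trans (ℕ.m≤n+m 6 3) n≥9) (C₄-2-colorable t>2) ,
    -- For t = 4 the bound 2 * t + 1 computes to 9.
    sharpen (¬Kₙ⊡C₄-colorable t>2 n≥9) (bcolorable⇒≤ t>2 (inj₁ n≥9))

  n+2-colors : (n ≡ 2 × t ≢ 4) ⊎ (n ≡ 3 ⊎ n ≡ 4) ⊎ (n ≥ 2 * t + 1 × t ≢ 4) →
               φ[ K n ⊡ C t t>2 ]≡ (2 + n)
  n+2-colors (inj₁ (refl , t≢4)) =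
    K₂-colorable t>2 (C-3-colorable t t>2 t≢4) , few-edges (s≤s z≤n)
  n+2-colors (inj₂ (inj₁ (inj₁ refl))) = K₃-colorable t>2 , few-edges (s≤s (s≤s (s≤s z≤n)))
  n+2-colors (inj₂ (inj₁ (inj₂ refl))) = K₄-colorable t>2 , few-edges ℕ.≤-refl
  n+2-colors (inj₂ (inj₂ (n≥ , t≢4))) =
    Kₙ-colorable₃ t>2 (ℕ.≤-trans t>2 (ℕ.≤-trans t≤2t+1 n≥)) (C-3-colorable t t>2 t≢4) ,
    bcolorable⇒≤ t>2 (inj₁ n≥)
    where
    t≤2t+1 : t ≤ 2 * t + 1
    t≤2t+1 = ℕ.≤-trans (ℕ.m≤n*m t 2) (ℕ.m≤m+n (2 * t) 1)
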